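{- For every ordinal $\alpha$: $\alpha$ is the ordinal height of some automatic well-founded partial order if and only if $\alpha<\omega^\omega$.
   Context: Automatic structures: for a finite alphabet $\Sigma$ and a padding symbol $\diamond\notin\Sigma$, the convolution of a tuple $(w_1,\dots,w_n)$ of words over $\Sigma$ is the word of length $\max_i|w_i|$ over the alphabet $(\Sigma\cup\{\diamond\})^n$ whose $k$-th letter is $(\sigma_1,\dots,\sigma_n)$, where $\sigma_i$ is the $k$-th letter of $w_i$ if $k\le |w_i|$ and $\diamond$ otherwise. An $n$-ary relation on $\Sigma^\star$ is regular if the set of convolutions of its tuples is accepted by a finite automaton. A structure $(A;R_1,\dots,R_m)$ with finitely many relations is automatic over $\Sigma$ if $A\subseteq\Sigma^\star$ is a regular language and each $R_i$ is a regular relation; a structure is called automatic if it is isomorphic to such a structure. Ordinal height: for a well-founded binary relation $R$ on $A$ (no infinite sequence $x_1,x_2,\dots$ with $(x_{i+1},x_i)\in R$ for all $i$), define $r_{\mathcal A}(x)=0$ for $R$-minimal $x$ and $r_{\mathcal A}(z)=\sup\{r_{\mathcal A}(y)+1:(y,z)\in R\}$ otherwise; the ordinal height of $(A;R)$ is $r(\mathcal A)=\sup\{r_{\mathcal A}(x):x\in A\}$. For a partial order $\le$, the relevant relation is the strict order $<$. -}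

module Defs where

open import Data.Nat using (ℕ; zero; suc)
open import Data.Fin using (Fin)
open import Data.Bool using (Bool; true)
open import Data.List using (List; []; _∷_; foldl)
open import Data.Maybe using (Maybe; just; nothing)
open import Data.Product using (Σ; ∃; _×_; _,_; proj₁)
open import Data.Sum using (_⊎_; inj₁; inj₂)
open import Data.Empty using (⊥; ⊥-elim)
open import Data.Unit using (⊤)
open import Relation.Nullary using (¬_)
open import Relation.Binary.PropositionalEquality using (_≡_)
open import Induction.WellFounded using (Acc; acc; WellFounded)

record DFA (A : Set) : Set where
  field
    nStates : ℕ
    start   : Fin nStates
    δ       : Fin nStates → A → Fin nStates
    final   : Fin nStates → Bool

Accepts : {A : Set} → DFA A → List A → Set
Accepts D w = DFA.final D (foldl (DFA.δ D) (DFA.start D) w) ≡ true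

-- Padded alphabet: nothing plays the role of the padding symbol ◇.
Padded : ℕ → Set
Padded k = Maybe (Fin k)

conv : {k : ℕ} → List (Fin k) → List (Fin k) → List (Padded k × Padded k)
conv []      []      = []
conv (a ∷ u) []      = (just a , nothing) ∷ conv u []
conv []      (b ∷ v) = (nothing , just b) ∷ conv [] v
conv (a ∷ u) (b ∷ v) = (just a , just b) ∷ conv u v

-- sup I f denotes the least ordinal strictly above every f i.
data Ord : Set₁ where
  sup : (I : Set) → (I → Ord) → Ord

mutual
  _≤ₒ_ : Ord → Ord → Set
  sup I f ≤ₒ β = (i : I) → f i <ₒ β

  _<ₒ_ : Ord → Ord → Set
  α <ₒ sup J g = Σ J (λ j → α ≤ₒ g j)

_≈ₒ_ : Ord → Ord → Set
α ≈ₒ β = (α ≤ₒ β) × (β ≤ₒ α)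

infix 4 _≤ₒ_ _<ₒ_ _≈ₒ_

zeroₒ : Ord
zeroₒ = sup ⊥ ⊥-elim

_+ₒ_ : Ord → Ord → Ord
sup J g +ₒ sup I f = sup (J ⊎ I) h
  where
    h : J ⊎ I → Ord
    h (inj₁ j) = g j
    h (inj₂ i) = sup J g +ₒ f i

_·ℕ_ : Ord → ℕ → Ord
α ·ℕ zero  = zeroₒ
α ·ℕ suc k = (α ·ℕ k) +ₒ α

ω^ : ℕ → Ord
ω^ zero    = sup ⊤ (λ _ → zeroₒ)
ω^ (suc n) = sup ℕ (λ k → ω^ n ·ℕ k)

ω^ω : Ord
ω^ω = sup ℕ ω^

module Height {D : Set} (_<_ : D → D → Set) (wf : WellFounded _<_) where

  rankAcc : (x : D) → Acc _<_ x → Ord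
  rankAcc x (acc rs) = sup (Σ D (λ y → y < x)) (λ p → rankAcc (proj₁ p) (rs (Data.Product.proj₂ p)))

  rank : D → Ord
  rank x = rankAcc x (wf x)

  -- r(A) = sup { r(x) : x ∈ A } = sup { r(y) + 1 : y < x, x ∈ A }
  height : Ord
  height = sup (Σ D (λ x → Σ D (λ y → y < x))) (λ p → rank (proj₁ (Data.Product.proj₂ p)))

record AutomaticWFPO : Set where
  field
    k    : ℕ
    Dom  : DFA (Fin k)
    Ord≤ : DFA (Padded k × Padded k)

  Carrier : Set
  Carrier = Σ (List (Fin k)) (Accepts Dom)

  _≤_ : Carrier → Carrier → Set
  x ≤ y = Accepts Ord≤ (conv (proj₁ x) (proj₁ y))

  _<_ : Carrier → Carrier → Set
  x < y = (x ≤ y) × ¬ (proj₁ x ≡ proj₁ y)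

  field
    refl≤    : ∀ x → x ≤ x
    antisym≤ : ∀ x y → x ≤ y → y ≤ x → proj₁ x ≡ proj₁ y
    trans≤   : ∀ x y z → x ≤ y → y ≤ z → x ≤ z
    wf<      : WellFounded _<_

  height : Ord
  height = Height.height _<_ wf<

{-# OPTIONS --safe #-}
module Submission where

-- Write ⟦ v ⟧ for the rank of v in the lexicographic order on ℕⁿ; these are the ordinals below ωⁿ.
--
-- Every α < ω^ω is ⟦ d ⟧ for some d. Cantor normal forms, written as words of exponents in
-- decreasing order and compared lexicographically, make {v : v ≼ d} an automatic linear order,
-- and its height is ⟦ d ⟧.
--
-- Conversely, for u in an automatic well-founded partial order, {x : x < u} is the union of
-- finitely many singletons and of the pieces {v w : v w < u, w nonempty} for |v| = |u|. The
-- isomorphism type of a piece is determined by the states reached by the automata after reading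
-- v, (v,u) and (v,v). There are finitely many such triples, so there is an M such that every piece
-- that embeds in some ℕᵐ embeds in ℕᴹ. By well-founded induction all ranks are below ω^(M+1): if
-- this holds below u, then all pieces embed in ℕᴹ⁺¹, hence in ℕᴹ, and the rank of u is at most the
-- natural sum (pointwise addition of coefficient vectors) of the finitely many heights of the pieces.

open import Defs
open import Level using (0ℓ; Lift; lift; lower)
open import Data.Product using (Σ; ∃; _×_; _,_; proj₁; proj₂)
open import Function.Bundles using (_⇔_; mk⇔)
open import Axiom.ExcludedMiddle using (ExcludedMiddle)

open import Data.Bool using (Bool; true; false; _∧_)
open import Data.Empty using (⊥-elim)
open import Data.Fin as Fin using (Fin; zero; suc; combine; remQuot)
open import Data.Fin.Properties as Fin using (remQuot-combine)
open import Data.List as List using (List; []; _∷_; [_]; _++_; map; foldl; length)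
open import Data.List.Properties using (foldl-++; ++-assoc; ++-identityʳ; ++-cancelˡ; length-++; ∷-injectiveʳ)
open import Data.List.Relation.Binary.Lex.Strict as ListLex using (base; halt; this; next)
open import Data.List.Relation.Binary.Pointwise as ListPointwise using ()
open import Data.List.Relation.Unary.Linked as Linked using (Linked; []; [-]; _∷_)
open import Data.List.Relation.Unary.Linked.Properties using (map⁺)
open import Data.Maybe using (just; nothing)
open import Data.Nat using (ℕ; zero; suc; pred; _<_; _≤_; z≤n; s≤s; _+_; _*_; _⊔_)
open import Data.Nat.Induction using (<-wellFounded)
open import Data.Nat.Properties as ℕ using (+-assoc; +-identityʳ; +-monoˡ-<; +-monoʳ-<; m<1+n⇒m<n∨m≡n; m≤n⇒m<n∨m≡n; m≤m⊔n; m≤n⊔m; n<1+n; ≤-pred)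
open import Data.Sum using (_⊎_; inj₁; inj₂)
open import Data.Unit using (tt)
open import Data.Vec using (Vec; []; _∷_; lookup; replicate; updateAt; zipWith)
open import Data.Vec.Properties using (lookup∘updateAt′; lookup-replicate)
open import Data.Vec.Relation.Binary.Lex.Strict as VecLex using (Lex-<; this; next)
open import Data.Vec.Relation.Binary.Pointwise.Inductive using (Pointwise-≡⇒≡; ≡⇒Pointwise-≡)
open import Function using (id)
open import Induction.WellFounded using (Acc; acc; WellFounded; module Subrelation)
open import Relation.Binary using (IsEquivalence; IsTotalOrder; tri<; tri≈; tri>)
open import Relation.Binary.Construct.Flip.EqAndOrd using (isStrictTotalOrder)
open import Relation.Binary.Construct.On using () renaming (wellFounded to on-wellFounded)
open import Relation.Binary.PropositionalEquality using (_≡_; _≢_; refl; sym; trans; cong; cong₂; subst)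
open import Relation.Binary.PropositionalEquality.Properties using (isEquivalence)
open import Relation.Nullary using (¬_; yes; no)
open import Relation.Nullary.Decidable using (map′; decidable-stable)

-- Ordinal order and monotonicity of addition

≤ₒ-refl : ∀ α → α ≤ₒ α
≤ₒ-refl (sup I f) i = i , ≤ₒ-refl (f i)

mutual
  ≤ₒ-trans : ∀ {α β γ} → α ≤ₒ β → β ≤ₒ γ → α ≤ₒ γ
  ≤ₒ-trans {sup I f} p q i = <ₒ-≤ₒ-trans (p i) q

  <ₒ-≤ₒ-trans : ∀ {α β γ} → α <ₒ β → β ≤ₒ γ → α <ₒ γ
  <ₒ-≤ₒ-trans {β = sup J g} (j , p) q = ≤ₒ-<ₒ-trans p (q j)

  ≤ₒ-<ₒ-trans : ∀ {α β γ} → α ≤ₒ β → β <ₒ γ → α <ₒ γ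
  ≤ₒ-<ₒ-trans {γ = sup K h} p (k , q) = k , ≤ₒ-trans p q

<ₒ⇒≤ₒ : ∀ {α β} → α <ₒ β → α ≤ₒ β
<ₒ⇒≤ₒ {sup I f} {sup J g} (j , p) i = j , <ₒ⇒≤ₒ (p i)

+ₒ-upperˡ : ∀ α β → α ≤ₒ α +ₒ β
+ₒ-upperˡ (sup J g) (sup I f) j = inj₁ j , ≤ₒ-refl (g j)

mutual
  +ₒ-monoʳ-≤ : ∀ α {β γ} → β ≤ₒ γ → α +ₒ β ≤ₒ α +ₒ γ
  +ₒ-monoʳ-≤ α@(sup J g) {sup I f} {sup K h} p (inj₁ j) = inj₁ j , ≤ₒ-refl (g j)
  +ₒ-monoʳ-≤ α@(sup J g) {sup I f} p (inj₂ i) = +ₒ-monoʳ-< α (p i)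

  +ₒ-monoʳ-< : ∀ α {β γ} → β <ₒ γ → α +ₒ β <ₒ α +ₒ γ
  +ₒ-monoʳ-< α@(sup J g) {γ = sup K h} (k , p) = inj₂ k , +ₒ-monoʳ-≤ α p

·ℕ-mono-< : ∀ α {a b} → a < b → α ·ℕ suc a ≤ₒ α ·ℕ b
·ℕ-mono-< α {a} {suc b} a<1+b with m<1+n⇒m<n∨m≡n a<1+b
... | inj₁ a<b  = ≤ₒ-trans (·ℕ-mono-< α a<b) (+ₒ-upperˡ (α ·ℕ b) α)
... | inj₂ refl = ≤ₒ-refl (α ·ℕ suc a)

-- Ranks of well-founded relations

module RankComparison {A B : Set} {_<A_ : A → A → Set} {_<B_ : B → B → Set}
  (wfA : WellFounded _<A_) (wfB : WellFounded _<B_) (f : A → B)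
  where

  private
    module A = Height _<A_ wfA
    module B = Height _<B_ wfB

  rank-mono : (∀ {x y} → x <A y → f x <B f y) → ∀ x → A.rank x ≤ₒ B.rank (f x)
  rank-mono mono x = go (wfA x) (wfB (f x))
    where
    go : ∀ {x} (p : Acc _<A_ x) (q : Acc _<B_ (f x)) → A.rankAcc x p ≤ₒ B.rankAcc (f x) q
    go (acc rs) (acc ss) (y , y<x) = (f y , mono y<x) , go (rs y<x) (ss (mono y<x))

  rank-reflect : (∀ x b → b <B f x → Σ A (λ y → y <A x × f y ≡ b)) →
                 ∀ x → B.rank (f x) ≤ₒ A.rank x
  rank-reflect preimage x = go (wfA x) (wfB (f x))
    where
    go : ∀ {x} (p : Acc _<A_ x) (q : Acc _<B_ (f x)) → B.rankAcc (f x) q ≤ₒ A.rankAcc x p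
    go {x} (acc rs) (acc ss) (b , b<fx) with preimage x b b<fx
    ... | y , y<x , refl = (y , y<x) , go (rs y<x) (ss b<fx)

module RankProperties {A : Set} {_<A_ : A → A → Set} (wf : WellFounded _<A_) where

  open Height _<A_ wf

  private
    -- Ranks are computed from accessibility proofs, and the proofs met in recursive calls differ
    -- from those given by `wf`. Comparing them up to `≤ₒ` is enough.
    rankAcc-irrelevant : ∀ {x} (p q : Acc _<A_ x) → rankAcc x p ≤ₒ rankAcc x q
    rankAcc-irrelevant (acc rs) (acc ss) (y , y<x) =
      (y , y<x) , rankAcc-irrelevant (rs y<x) (ss y<x)

  <⇒rank< : ∀ {y x} → y <A x → rank y <ₒ rank x
  <⇒rank< {y} {x} y<x with wf x
  ... | acc rs = (y , y<x) , rankAcc-irrelevant (wf y) (rs y<x)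

  rank-least : ∀ x {β} → (∀ y → y <A x → rank y <ₒ β) → rank x ≤ₒ β
  rank-least x bound with wf x
  ... | acc rs = λ (y , y<x) → ≤ₒ-<ₒ-trans (rankAcc-irrelevant (rs y<x) (wf y)) (bound y y<x)

  <rank⇒≤rank : ∀ {α} x → α <ₒ rank x → Σ A (λ y → y <A x × α ≤ₒ rank y)
  <rank⇒≤rank x α< with wf x
  <rank⇒≤rank x ((y , y<x) , p) | acc rs = y , y<x , ≤ₒ-trans p (rankAcc-irrelevant (rs y<x) (wf y))

-- Lexicographic order on coefficient vectors

infix 4 _≺_ _≼_

_≺_ : ∀ {n} → Vec ℕ n → Vec ℕ n → Set
_≺_ = Lex-< _≡_ _<_

_≼_ : ∀ {n} → Vec ℕ n → Vec ℕ n → Set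
u ≼ v = u ≺ v ⊎ u ≡ v

≺-wellFounded : ∀ {n} → WellFounded (_≺_ {n})
≺-wellFounded = VecLex.<-wellFounded trans (proj₁ ℕ.<-resp₂-≡) <-wellFounded

≺-trans : ∀ {n} {u v w : Vec ℕ n} → u ≺ v → v ≺ w → u ≺ w
≺-trans = VecLex.<-trans (IsEquivalence.isPartialEquivalence isEquivalence) ℕ.<-resp₂-≡ ℕ.<-trans

≺-irrefl : ∀ {n} {u : Vec ℕ n} → ¬ u ≺ u
≺-irrefl = VecLex.<-irrefl ℕ.<-irrefl (≡⇒Pointwise-≡ refl)

≺-or-≽ : ∀ {n} (u v : Vec ℕ n) → u ≺ v ⊎ v ≼ u
≺-or-≽ u v with VecLex.<-cmp sym ℕ.<-cmp u v
... | tri< u≺v _ _ = inj₁ u≺v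
... | tri≈ _ u≋v _ = inj₂ (inj₂ (sym (Pointwise-≡⇒≡ u≋v)))
... | tri> _ _ v≺u = inj₂ (inj₁ v≺u)

≼-≺-trans : ∀ {n} {u v w : Vec ℕ n} → u ≼ v → v ≺ w → u ≺ w
≼-≺-trans (inj₁ u≺v)  v≺w = ≺-trans u≺v v≺w
≼-≺-trans (inj₂ refl) v≺w = v≺w

≺-≼-trans : ∀ {n} {u v w : Vec ℕ n} → u ≺ v → v ≼ w → u ≺ w
≺-≼-trans u≺v (inj₁ v≺w)  = ≺-trans u≺v v≺w
≺-≼-trans u≺v (inj₂ refl) = u≺v

𝟎 : ∀ {n} → Vec ℕ n
𝟎 = replicate _ 0

𝟎-least : ∀ {n} (v : Vec ℕ n) → 𝟎 ≼ v
𝟎-least []          = inj₂ refl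
𝟎-least (suc a ∷ v) = inj₁ (this (s≤s z≤n) refl)
𝟎-least (zero ∷ v) with 𝟎-least v
... | inj₁ lt = inj₁ (next refl lt)
... | inj₂ eq = inj₂ (cong (0 ∷_) eq)

-- The Hessenberg sum of Cantor normal forms. Unlike ordinal addition, it is strictly monotone in
-- both arguments.
_⊞_ : ∀ {n} → Vec ℕ n → Vec ℕ n → Vec ℕ n
_⊞_ = zipWith _+_

⊞-monoˡ-≺ : ∀ {n} {u v : Vec ℕ n} w → u ≺ v → u ⊞ w ≺ v ⊞ w
⊞-monoˡ-≺ (c ∷ w) (this a<b eq)   = this (+-monoˡ-< c a<b) eq
⊞-monoˡ-≺ (c ∷ w) (next refl u≺v) = next refl (⊞-monoˡ-≺ w u≺v)

⊞-monoʳ-≺ : ∀ {n} (w : Vec ℕ n) {u v} → u ≺ v → w ⊞ u ≺ w ⊞ v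
⊞-monoʳ-≺ (c ∷ w) (this a<b eq)   = this (+-monoʳ-< c a<b) eq
⊞-monoʳ-≺ (c ∷ w) (next refl u≺v) = next refl (⊞-monoʳ-≺ w u≺v)

⊞-mono-≼ : ∀ {n} {u v w x : Vec ℕ n} → u ≼ v → w ≼ x → u ⊞ w ≼ v ⊞ x
⊞-mono-≼ {w = w} (inj₁ p) (inj₁ q) = inj₁ (≺-trans (⊞-monoˡ-≺ w p) (⊞-monoʳ-≺ _ q))
⊞-mono-≼ {w = w} (inj₁ p) (inj₂ refl) = inj₁ (⊞-monoˡ-≺ w p)
⊞-mono-≼ (inj₂ refl) (inj₁ q) = inj₁ (⊞-monoʳ-≺ _ q)
⊞-mono-≼ (inj₂ refl) (inj₂ refl) = inj₂ refl

⊞-mono-≺-≼ : ∀ {n} {u v w x : Vec ℕ n} → u ≺ v → w ≼ x → u ⊞ w ≺ v ⊞ x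
⊞-mono-≺-≼ {w = w} p q = ≺-≼-trans (⊞-monoˡ-≺ w p) (⊞-mono-≼ (inj₂ refl) q)

⊞-mono-≼-≺ : ∀ {n} {u v w x : Vec ℕ n} → u ≼ v → w ≺ x → u ⊞ w ≺ v ⊞ x
⊞-mono-≼-≺ {v = v} p q = ≼-≺-trans (⊞-mono-≼ p (inj₂ refl)) (⊞-monoʳ-≺ v q)

-- Vectors as ordinals below the powers of ω

-- ⟦ aₙ₋₁ ∷ … ∷ a₀ ∷ [] ⟧ is the ordinal ω^(n-1)·aₙ₋₁ + … + a₀.
⟦_⟧ : ∀ {n} → Vec ℕ n → Ord
⟦_⟧ = Height.rank _≺_ ≺-wellFounded

private module Val {n : ℕ} = RankProperties (≺-wellFounded {n})

⟦⟧-mono-≼ : ∀ {n} {u v : Vec ℕ n} → u ≼ v → ⟦ u ⟧ ≤ₒ ⟦ v ⟧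
⟦⟧-mono-≼ (inj₁ u≺v)      = <ₒ⇒≤ₒ (Val.<⇒rank< u≺v)
⟦⟧-mono-≼ {u = u} (inj₂ refl) = ≤ₒ-refl ⟦ u ⟧

mutual
  -- If the leading coefficient drops to `b < a`, the tail stays below `ω^ n`, so the whole fits
  -- into `b + 1` copies of `ω^ n`. If it is unchanged, the tail has decreased.
  ⟦∷⟧-upper : ∀ {n} a (v : Vec ℕ n) → Acc _≺_ (a ∷ v) → ⟦ a ∷ v ⟧ ≤ₒ (ω^ n ·ℕ a) +ₒ ⟦ v ⟧
  ⟦∷⟧-upper {n} a v (acc rs) = Val.rank-least (a ∷ v) bound
    where
    bound : ∀ u → u ≺ a ∷ v → ⟦ u ⟧ <ₒ (ω^ n ·ℕ a) +ₒ ⟦ v ⟧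
    bound (b ∷ w) lt@(next refl w≺v) =
      ≤ₒ-<ₒ-trans (⟦∷⟧-upper b w (rs lt)) (+ₒ-monoʳ-< (ω^ n ·ℕ b) (Val.<⇒rank< w≺v))
    bound (b ∷ w) lt@(this b<a refl) =
      ≤ₒ-<ₒ-trans (⟦∷⟧-upper b w (rs lt))
        (<ₒ-≤ₒ-trans (+ₒ-monoʳ-< (ω^ n ·ℕ b) (⟦⟧<ω^ w))
          (≤ₒ-trans (·ℕ-mono-< (ω^ n) b<a) (+ₒ-upperˡ (ω^ n ·ℕ a) ⟦ v ⟧)))

  ⟦⟧<ω^ : ∀ {n} (v : Vec ℕ n) → ⟦ v ⟧ <ₒ ω^ n
  ⟦⟧<ω^ [] = tt , Val.rank-least [] (λ { [] lt → ⊥-elim (≺-irrefl lt) })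
  ⟦⟧<ω^ {suc n} (a ∷ v) = suc a ,
    ≤ₒ-trans (⟦∷⟧-upper a v (≺-wellFounded (a ∷ v)))
      (+ₒ-monoʳ-≤ (ω^ n ·ℕ a) (<ₒ⇒≤ₒ (⟦⟧<ω^ v)))

-- Recursion on `β`. What lies below `α` lies below `a ∷ 𝟎`, and `𝟎 ≼ v`; a component of `β` is
-- dominated by some `w ≺ v` under the same leading coefficient.
⟦∷⟧-lower : ∀ {n α} β a (v : Vec ℕ n) → α ≤ₒ ⟦ a ∷ 𝟎 {n} ⟧ → β ≤ₒ ⟦ v ⟧ → α +ₒ β ≤ₒ ⟦ a ∷ v ⟧
⟦∷⟧-lower {α = sup J g} (sup I f) a v p q (inj₁ j) = <ₒ-≤ₒ-trans (p j) (⟦⟧-mono-≼ (a∷-mono (𝟎-least v)))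
  where
  a∷-mono : ∀ {w} → w ≼ v → a ∷ w ≼ a ∷ v
  a∷-mono (inj₁ lt)   = inj₁ (next refl lt)
  a∷-mono (inj₂ refl) = inj₂ refl
⟦∷⟧-lower {α = sup J g} (sup I f) a v p q (inj₂ i) with Val.<rank⇒≤rank v (q i)
... | w , w≺v , r = ≤ₒ-<ₒ-trans (⟦∷⟧-lower (f i) a w p r) (Val.<⇒rank< {y = a ∷ w} (next refl w≺v))

mutual
  -- An ordinal below `ω^ (suc n)` is at most some `ω^ n ·ℕ k`, which the vector `k ∷ 𝟎` dominates
  -- by `ω^·≤`.
  ω^-cofinal : ∀ n α → α <ₒ ω^ n → Σ (Vec ℕ n) (λ v → α ≤ₒ ⟦ v ⟧)
  ω^-cofinal zero (sup I f) (tt , p) = [] , λ i → ⊥-elim (proj₁ (p i))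
  ω^-cofinal (suc n) α (k , p) = k ∷ 𝟎 , ≤ₒ-trans p (ω^·≤ n k)

  ω^·≤ : ∀ n k → ω^ n ·ℕ k ≤ₒ ⟦ k ∷ 𝟎 {n} ⟧
  ω^·≤ n zero ()
  ω^·≤ n (suc k) = step (ω^ n ·ℕ k) (ω^ n) (ω^·≤ n k) (ω^-cofinal n)
    where
    k≺1+k : ∀ v → k ∷ v ≺ suc k ∷ 𝟎 {n}
    k≺1+k v = this (n<1+n k) refl

    -- The two powers are abstracted to variables so that both can be matched as `sup`, which is
    -- what makes the sum reduce.
    step : ∀ α β → α ≤ₒ ⟦ k ∷ 𝟎 {n} ⟧ → (∀ γ → γ <ₒ β → Σ (Vec ℕ n) (λ v → γ ≤ₒ ⟦ v ⟧)) →
           α +ₒ β ≤ₒ ⟦ suc k ∷ 𝟎 {n} ⟧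
    step (sup J g) (sup I f) p cof (inj₁ j) = <ₒ-≤ₒ-trans (p j) (⟦⟧-mono-≼ (inj₁ (k≺1+k 𝟎)))
    step (sup J g) (sup I f) p cof (inj₂ i) with cof (f i) (i , ≤ₒ-refl (f i))
    ... | v , q = ≤ₒ-<ₒ-trans (⟦∷⟧-lower (f i) k v p q) (Val.<⇒rank< (k≺1+k v))

-- The bound may be `ω^ n` itself, which exceeds every vector of length `n`; hence one more
-- coordinate and the witness `1 ∷ 𝟎`.
<ω^ω⇒≤⟦⟧ : ∀ {α} → α <ₒ ω^ω → ∃ (λ n → Σ (Vec ℕ (suc n)) (λ v → α ≤ₒ ⟦ v ⟧))
<ω^ω⇒≤⟦⟧ {α} (n , p) = n , 1 ∷ 𝟎 , ≤ₒ-trans p (≤-1∷𝟎 (ω^ n) (ω^-cofinal n))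
  where
  pad-≤ : ∀ {n} (v : Vec ℕ n) → ⟦ v ⟧ ≤ₒ ⟦ 0 ∷ v ⟧
  pad-≤ = RankComparison.rank-mono ≺-wellFounded ≺-wellFounded (0 ∷_) (next refl)

  ≤-1∷𝟎 : ∀ β → (∀ γ → γ <ₒ β → Σ (Vec ℕ n) (λ v → γ ≤ₒ ⟦ v ⟧)) → β ≤ₒ ⟦ 1 ∷ 𝟎 {n} ⟧
  ≤-1∷𝟎 (sup I f) cof i with cof (f i) (i , ≤ₒ-refl (f i))
  ... | v , q = ≤ₒ-<ₒ-trans (≤ₒ-trans q (pad-≤ v)) (Val.<⇒rank< {y = 0 ∷ v} (this (s≤s z≤n) refl))

-- Classical principles: comparability, least vectors, uniform bounds

module Classical (em : ExcludedMiddle 0ℓ) where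

  -- If some `f i` is not below `β`, then by induction every `g j` is below `f i`. Hence `β ≤ₒ f i`,
  -- and so `β <ₒ α`.
  ¬≤ₒ⇒>ₒ : ∀ α β → ¬ α ≤ₒ β → β <ₒ α
  ¬≤ₒ⇒>ₒ (sup I f) (sup J g) α≰β = decidable-stable em λ β≮α →
    α≰β λ i → decidable-stable em λ fi≮β →
      β≮α (i , λ j → ¬≤ₒ⇒>ₒ (f i) (g j) λ fi≤gj → fi≮β (j , fi≤gj))

  least : ∀ {n} (P : Vec ℕ n → Set) → ∃ P → Σ (Vec ℕ n) (λ d → P d × (∀ e → P e → d ≼ e))
  least P (d , p) = go d p (≺-wellFounded d)
    where
    go : ∀ d → P d → Acc _≺_ d → Σ _ (λ d → P d × (∀ e → P e → d ≼ e))
    go d p (acc rs) with em {P = Σ _ (λ e → P e × e ≺ d)}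
    ... | yes (e , q , e≺d) = go e q (rs e≺d)
    ... | no ∄ = d , p , minimal
      where
      minimal : ∀ e → P e → d ≼ e
      minimal e q with ≺-or-≽ e d
      ... | inj₁ e≺d = ⊥-elim (∄ (e , q , e≺d))
      ... | inj₂ d≼e = d≼e

  -- For the least `d` that dominates `α`, no `e ≺ d` dominates `α`, so comparability puts each such
  -- `⟦ e ⟧` strictly below `α`.
  ≤⟦⟧⇒≈⟦⟧ : ∀ {n} α (v : Vec ℕ n) → α ≤ₒ ⟦ v ⟧ → Σ (Vec ℕ n) (λ d → α ≈ₒ ⟦ d ⟧)
  ≤⟦⟧⇒≈⟦⟧ α v α≤v with least (λ d → α ≤ₒ ⟦ d ⟧) (v , α≤v)
  ... | d , α≤d , minimal = d , α≤d , Val.rank-least d λ e e≺d →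
    ¬≤ₒ⇒>ₒ α ⟦ e ⟧ λ α≤e → ≺-irrefl (≺-≼-trans e≺d (minimal e α≤e))

  UpwardClosed : (ℕ → Set) → Set
  UpwardClosed P = ∀ m → P m → P (suc m)

  upward-≤ : ∀ {P} → UpwardClosed P → ∀ {m n} → m ≤ n → P m → P n
  upward-≤ up {n = zero}  z≤n p = p
  upward-≤ up {n = suc n} m≤1+n p with m≤n⇒m<n∨m≡n m≤1+n
  ... | inj₁ m<1+n = up n (upward-≤ up (≤-pred m<1+n) p)
  ... | inj₂ refl  = p

  -- Finiteness of `A`, in the form in which it is applied to automaton states.
  UniformlyBounding : Set → Set₁
  UniformlyBounding A = (P : A → ℕ → Set) → (∀ a → UpwardClosed (P a)) →
                        ∃ λ M → ∀ a → ∃ (P a) → P a M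

  bounding-Fin : ∀ n → UniformlyBounding (Fin n)
  bounding-Fin zero    P up = 0 , λ ()
  bounding-Fin (suc n) P up
    with bounding-Fin n (λ i → P (suc i)) (λ i → up (suc i)) | em {P = ∃ (P zero)}
  ... | M , bound | no ∄ =
        M , λ { zero p → ⊥-elim (∄ p) ; (suc i) p → bound i p }
  ... | M , bound | yes (m , p₀) =
        m ⊔ M , λ { zero    _ → upward-≤ (up zero) (m≤m⊔n m M) p₀
                  ; (suc i) p → upward-≤ (up (suc i)) (m≤n⊔m m M) (bound i p) }

  -- For fixed `a`, `bB` yields one number good for all `b`; `bA` then makes this number independent
  -- of `a`.
  bounding-× : ∀ {A B} → UniformlyBounding A → UniformlyBounding B → UniformlyBounding (A × B)
  bounding-× bA bB P up
    with bA (λ a m → ∀ b → ∃ (P (a , b)) → P (a , b) m) (λ a m h b e → up (a , b) m (h b e))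
  ... | M , bound = M , λ (a , b) → bound a (bB (λ b → P (a , b)) (λ b → up (a , b))) b

  -- Relative ranks of subsets and their natural sums

  module Partition {A : Set} (_<A_ : A → A → Set)
                   (<A-trans : ∀ x y z → x <A y → y <A z → x <A z)
    where

    -- Such an f plays the role of x ↦ height {y ∈ X : y < x}, an ordinal below ωⁿ.
    RelRank : ℕ → (A → Set) → Set
    RelRank n X = Σ (A → Vec ℕ n) λ f →
      (∀ y x → y <A x → f y ≼ f x) × (∀ y x → X y → y <A x → f y ≺ f x)

    relRank-⊆ : ∀ {n} {X Y : A → Set} → (∀ x → X x → Y x) → RelRank n Y → RelRank n X
    relRank-⊆ X⊆Y (f , weak , strict) = f , weak , λ y x y∈X → strict y x (X⊆Y y y∈X)

    -- A step from `y` is strict in the summand whose set contains `y` and weak in the other. This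
    -- is why weak monotonicity is recorded on all of `A`.
    relRank-∪ : ∀ {n} {X Y : A → Set} → RelRank n X → RelRank n Y → RelRank n (λ x → X x ⊎ Y x)
    relRank-∪ {n} {X} {Y} (f , f-weak , f-strict) (g , g-weak , g-strict) =
      (λ x → f x ⊞ g x) , (λ y x y<x → ⊞-mono-≼ (f-weak y x y<x) (g-weak y x y<x)) , strict
      where
      strict : ∀ y x → X y ⊎ Y y → y <A x → f y ⊞ g y ≺ f x ⊞ g x
      strict y x (inj₁ y∈X) y<x = ⊞-mono-≺-≼ (f-strict y x y∈X y<x) (g-weak y x y<x)
      strict y x (inj₂ y∈Y) y<x = ⊞-mono-≼-≺ (f-weak y x y<x) (g-strict y x y∈Y y<x)

    relRank-⋃ : ∀ {n k} {X : Fin k → A → Set} → (∀ i → RelRank n (X i)) →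
                RelRank n (λ x → ∃ λ i → X i x)
    relRank-⋃ {k = zero}  _ = (λ _ → 𝟎) , (λ _ _ _ → inj₂ refl) , λ _ _ ()
    relRank-⋃ {k = suc k} r =
      relRank-⊆ (λ { _ (zero , p) → inj₁ p ; _ (suc i , p) → inj₂ (i , p) })
        (relRank-∪ (r zero) (relRank-⋃ (λ i → r (suc i))))

    -- The supremum of f over {y ∈ X : y < x} exists because 1 ∷ 𝟎 bounds every 0 ∷ v.
    relRank-extend : ∀ {n} {X : A → Set} (f : ∀ x → X x → Vec ℕ n) →
      (∀ y x (p : X y) (q : X x) → y <A x → f y p ≺ f x q) → RelRank (suc n) X
    relRank-extend {n} {X} f mono = F , weak , strict
      where
      Bounds : A → Vec ℕ (suc n) → Set
      Bounds x d = ∀ y (p : X y) → y <A x → 0 ∷ f y p ≺ d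

      sup-f : ∀ x → Σ (Vec ℕ (suc n)) (λ d → Bounds x d × (∀ e → Bounds x e → d ≼ e))
      sup-f x = least (Bounds x) (1 ∷ 𝟎 , λ _ _ _ → this (s≤s z≤n) refl)

      F : A → Vec ℕ (suc n)
      F x = proj₁ (sup-f x)

      F-bounds : ∀ x → Bounds x (F x)
      F-bounds x = proj₁ (proj₂ (sup-f x))

      F-least : ∀ x e → Bounds x e → F x ≼ e
      F-least x = proj₂ (proj₂ (sup-f x))

      weak : ∀ y x → y <A x → F y ≼ F x
      weak y x y<x = F-least y (F x) λ z p z<y → F-bounds x z p (<A-trans z y x z<y y<x)

      strict : ∀ y x → X y → y <A x → F y ≺ F x
      strict y x p y<x =
        -- By `mono`, the value `0 ∷ f y p` is itself a bound at `y`, and it lies strictly below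
        -- `F x`.
        ≼-≺-trans (F-least y (0 ∷ f y p) λ z q z<y → next refl (mono z y q p z<y)) (F-bounds x y p y<x)

-- Convolutions and automaton runs on concatenations

-- Equal lengths keep padding out of the prefixes, so the convolution splits exactly where they end.
conv-++ : ∀ {k} (u v : List (Fin k)) {w x} → length u ≡ length v →
          conv (u ++ w) (v ++ x) ≡ conv u v ++ conv w x
conv-++ []      []      eq = refl
conv-++ (a ∷ u) (b ∷ v) eq = cong (_ ∷_) (conv-++ u v (cong pred eq))

++-same-length : ∀ {A : Set} (v u : List A) {w} → length v ≡ length u → v ++ w ≡ u → w ≡ []
++-same-length []      []      _   eq = eq
++-same-length (_ ∷ v) (_ ∷ u) len eq = ++-same-length v u (cong pred len) (∷-injectiveʳ eq)

run : ∀ {A} (D : DFA A) → Fin (DFA.nStates D) → List A → Fin (DFA.nStates D)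
run D = foldl (DFA.δ D)

AcceptsFrom : ∀ {A} (D : DFA A) → Fin (DFA.nStates D) → List A → Set
AcceptsFrom D q w = DFA.final D (run D q w) ≡ true

acceptsFrom-++ : ∀ {A} (D : DFA A) q u w → AcceptsFrom D q (u ++ w) ≡ AcceptsFrom D (run D q u) w
acceptsFrom-++ D q u w = cong (λ s → DFA.final D s ≡ true) (foldl-++ (DFA.δ D) q u w)

-- Heights of automatic well-founded partial orders lie below ω^ω

module UpperBound (em : ExcludedMiddle 0ℓ) (P : AutomaticWFPO) where

  open Classical em
  open AutomaticWFPO P renaming (_<_ to _<P_; _≤_ to _≤P_)
  open Height _<P_ wf< using (rank)
  open RankProperties wf< using (<⇒rank<; rank-least)

  <P-trans : ∀ x y z → x <P y → y <P z → x <P z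
  <P-trans x y z (x≤y , x≢y) (y≤z , y≢z) = trans≤ x y z x≤y y≤z , x≢z
    where
    x≢z : proj₁ x ≢ proj₁ z
    x≢z x≡z = x≢y (antisym≤ x y x≤y (subst (λ t → Accepts Ord≤ (conv (proj₁ y) t)) (sym x≡z) y≤z))

  open Partition _<P_ <P-trans

  Word : Set
  Word = List (Fin k)

  Q S : Set
  Q = Fin (DFA.nStates Dom)
  S = Fin (DFA.nStates Ord≤)

  domState : Word → Q
  domState = run Dom (DFA.start Dom)

  ordState : Word → Word → S
  ordState u v = run Ord≤ (DFA.start Ord≤) (conv u v)

  -- With |v| = |u|, the words v ++ w ≤ u with w ≢ [] form a suborder that depends only on
  -- the states s = domState v, p = ordState v u and q = ordState v v.
  Piece : Q → S → Word → Set
  Piece s p w = w ≢ [] × AcceptsFrom Dom s w × AcceptsFrom Ord≤ p (conv w [])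

  -- The state `q` replaces the comparison of `v ++ w` with `v ++ x`, so only finitely many such
  -- properties occur for each `m`.
  Embeds : Q → S → S → ℕ → Set
  Embeds s p q m = Σ (∀ w → Piece s p w → Vec ℕ m) λ g →
    ∀ {w x} (a : Piece s p w) (b : Piece s p x) →
      AcceptsFrom Ord≤ q (conv w x) → w ≢ x → g w a ≺ g x b

  -- `M` depends on the automata alone and is fixed before any element `u` is considered.
  embeds-bound : ∃ λ M → ∀ s p q → ∃ (Embeds s p q) → Embeds s p q M
  embeds-bound with bounding-× (bounding-Fin _) (bounding-× (bounding-Fin _) (bounding-Fin _))
                      (λ (s , p , q) → Embeds s p q) (λ _ _ → embeds-suc)
    where
    embeds-suc : ∀ {s p q m} → Embeds s p q m → Embeds s p q (suc m)
    embeds-suc (g , mono) =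
      (λ w a → 0 ∷ g w a) , λ a b w≤x w≢x → next refl (mono a b w≤x w≢x)
  ... | M , bound = M , λ s p q → bound (s , p , q)

  module Bound (M : ℕ) (embeds-M : ∀ s p q → ∃ (Embeds s p q) → Embeds s p q M) where

    -- The length `suc M` reproduces itself in the induction: the uniform bound lowers it to `M`,
    -- and taking suprema in `relRank-extend` restores it.
    Bounded : Carrier → Set
    Bounded x = Σ (Vec ℕ (suc M)) λ d → rank x ≤ₒ ⟦ d ⟧

    module Step (u : Carrier) (below : ∀ y → y <P u → Bounded y) where

      module _ (v : Word) (|v|≡|u| : length v ≡ length (proj₁ u)) where

        s = domState v
        p = ordState v (proj₁ u)
        q = ordState v v

        dom-++ : ∀ w → Accepts Dom (v ++ w) ≡ AcceptsFrom Dom s w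
        dom-++ = acceptsFrom-++ Dom (DFA.start Dom) v

        ord-++ : ∀ t {w x} → length v ≡ length t →
                 Accepts Ord≤ (conv (v ++ w) (t ++ x)) ≡ AcceptsFrom Ord≤ (ordState v t) (conv w x)
        ord-++ t {w} {x} eq =
          trans (cong (Accepts Ord≤) (conv-++ v t eq))
                (acceptsFrom-++ Ord≤ (DFA.start Ord≤) (conv v t) (conv w x))

        ord-u : ∀ {w} → Accepts Ord≤ (conv (v ++ w) (proj₁ u)) ≡ AcceptsFrom Ord≤ p (conv w [])
        ord-u {w} = trans (cong (λ t → Accepts Ord≤ (conv (v ++ w) t)) (sym (++-identityʳ (proj₁ u))))
                          (ord-++ (proj₁ u) |v|≡|u|)

        element : ∀ w → Piece s p w → Carrier
        element w (_ , a , _) = v ++ w , subst id (sym (dom-++ w)) a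

        element<u : ∀ w (a : Piece s p w) → element w a <P u
        element<u w (w≢[] , _ , w≤) =
          subst id (sym ord-u) w≤ , λ eq → w≢[] (++-same-length v (proj₁ u) |v|≡|u| eq)

        -- Each word is sent to the least vector dominating the rank of its element. An arbitrary
        -- dominating vector would not be monotone.
        piece-embeds : Embeds s p q (suc M)
        piece-embeds = g , mono
          where
          bound : ∀ w a → Σ (Vec ℕ (suc M)) λ d →
                  rank (element w a) ≤ₒ ⟦ d ⟧ × (∀ e → rank (element w a) ≤ₒ ⟦ e ⟧ → d ≼ e)
          bound w a = least (λ d → rank (element w a) ≤ₒ ⟦ d ⟧) (below (element w a) (element<u w a))

          g : ∀ w → Piece s p w → Vec ℕ (suc M)
          g w a = proj₁ (bound w a)

          mono : ∀ {w x} (a : Piece s p w) (b : Piece s p x) →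
                 AcceptsFrom Ord≤ q (conv w x) → w ≢ x → g w a ≺ g x b
          mono {w} {x} a b w≤x w≢x = conclude (Val.<rank⇒≤rank (g x b) rank<)
            where
            w<x : element w a <P element x b
            w<x = subst id (sym (ord-++ v refl)) w≤x , λ eq → w≢x (++-cancelˡ v w x eq)

            rank< : rank (element w a) <ₒ ⟦ g x b ⟧
            rank< = <ₒ-≤ₒ-trans (<⇒rank< {element w a} {element x b} w<x) (proj₁ (proj₂ (bound x b)))

            conclude : Σ (Vec ℕ (suc M)) (λ e → e ≺ g x b × rank (element w a) ≤ₒ ⟦ e ⟧) → g w a ≺ g x b
            conclude (e , e≺ , rank≤e) = ≼-≺-trans (proj₂ (proj₂ (bound w a)) e rank≤e) e≺

        Tail : Carrier → Set
        Tail x = x <P u × Σ Word λ w → w ≢ [] × proj₁ x ≡ v ++ w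

        relRank-tail : RelRank (suc M) Tail
        -- An embedding of length `suc M` exists, so one of length `M` does; the saved coordinate
        -- pays for the supremum.
        relRank-tail = extend (embeds-M s p q (suc M , piece-embeds))
          where
          word : ∀ x → Tail x → Word
          word x (_ , w , _) = w

          piece : ∀ x (a : Tail x) → Piece s p (word x a)
          piece (_ , x∈) ((x≤u , _) , w , w≢[] , refl) = w≢[] , subst id (dom-++ w) x∈ , subst id ord-u x≤u

          extend : Embeds s p q M → RelRank (suc M) Tail
          extend (g , g-mono) = relRank-extend (λ x a → g (word x a) (piece x a)) mono
            where
            mono : ∀ y x (a : Tail y) (b : Tail x) → y <P x →
                   g (word y a) (piece y a) ≺ g (word x b) (piece x b)
            mono y x a@(_ , _ , _ , refl) b@(_ , _ , _ , refl) (y≤x , y≢x) =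
              g-mono (piece y a) (piece x b) (subst id (ord-++ v refl) y≤x) λ eq → y≢x (cong (v ++_) eq)

      relRank-singleton : ∀ v → RelRank (suc M) (λ x → proj₁ x ≡ v)
      relRank-singleton v =
        relRank-extend (λ _ _ → 𝟎) λ _ _ y≡v x≡v (_ , y≢x) → ⊥-elim (y≢x (trans y≡v (sym x≡v)))

      -- Recursion on the number `j` of letters by which `v` is shorter than `u`: an extension of
      -- `v` is `v` itself or continues with one of finitely many letters. At equal length, the
      -- proper extensions form a single piece.
      relRank-extensions : ∀ j v → length v + j ≡ length (proj₁ u) →
                           RelRank (suc M) (λ x → x <P u × Σ Word λ w → proj₁ x ≡ v ++ w)
      relRank-extensions zero v eq =
        relRank-⊆ (λ { _ (_ , [] , e) → inj₁ (trans e (++-identityʳ v))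
                     ; _ (x<u , w@(_ ∷ _) , e) → inj₂ (x<u , w , (λ ()) , e) })
          (relRank-∪ (relRank-singleton v) (relRank-tail v (trans (sym (+-identityʳ (length v))) eq)))
      relRank-extensions (suc j) v eq =
        relRank-⊆ (λ { _ (_ , [] , e) → inj₁ (trans e (++-identityʳ v))
                     ; _ (x<u , a ∷ w , e) → inj₂ (a , x<u , w , trans e (sym (++-assoc v [ a ] w))) })
          (relRank-∪ (relRank-singleton v)
            (relRank-⋃ λ a → relRank-extensions j (v ++ [ a ]) (trans (shift a) eq)))
        where
        shift : ∀ a → length (v ++ [ a ]) + j ≡ length v + suc j
        shift a = trans (cong (_+ j) (length-++ v)) (+-assoc (length v) 1 j)

      bounded : Bounded u
      bounded with relRank-extensions (length (proj₁ u)) [] refl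
      ... | f , _ , strict = f u , rank≤ u (λ z z<u → z<u) (wf< u)
        where
        -- Stated for all `x` whose predecessors lie below `u`, which includes `u` itself.
        rank≤ : ∀ x → (∀ z → z <P x → z <P u) → Acc _<P_ x → rank x ≤ₒ ⟦ f x ⟧
        rank≤ x ↓x⊆↓u (acc rs) = rank-least x λ y y<x →
          ≤ₒ-<ₒ-trans (rank≤ y (λ z z<y → ↓x⊆↓u z (<P-trans z y x z<y y<x)) (rs y<x))
                      (Val.<⇒rank< (strict y x (↓x⊆↓u y y<x , proj₁ y , refl) y<x))

    all-bounded : ∀ u → Acc _<P_ u → Bounded u
    all-bounded u (acc rs) = Step.bounded u λ y y<u → all-bounded y (rs y<u)

    height≤ω^ : height ≤ₒ ω^ (suc M)
    height≤ω^ (_ , y , _) with all-bounded y (wf< y)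
    ... | d , y≤d = ≤ₒ-<ₒ-trans y≤d (⟦⟧<ω^ d)

  height<ω^ω : height <ₒ ω^ω
  height<ω^ω with embeds-bound
  ... | M , bound = suc M , Bound.height≤ω^ M bound

-- An automaton for the lexicographic order

-- A letter i of a sorted word over Fin k stands for ω^(k-1-i), so smaller indices are larger letters.
infix 4 _⊑_

_⊑_ : ∀ {k} → List (Fin k) → List (Fin k) → Set
_⊑_ = ListLex.Lex-≤ _≡_ Fin._>_

module ⊑ {k : ℕ} where
  open IsTotalOrder (ListLex.≤-isTotalOrder {A = Fin k} (isStrictTotalOrder Fin.<-isStrictTotalOrder)) public

[]⊑ : ∀ {k} (v : List (Fin k)) → [] ⊑ v
[]⊑ []      = base tt
[]⊑ (_ ∷ _) = halt

-- States: 0 = equal so far, 1 = less, 2 = greater.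
lexDFA : ∀ k → DFA (Padded k × Padded k)
lexDFA k = record { nStates = 3 ; start = zero ; δ = δ ; final = final }
  where
  δ : Fin 3 → Padded k × Padded k → Fin 3
  δ (suc i) _ = suc i
  -- The left word ends first with no difference so far, so it is a proper prefix.
  δ zero (nothing , _) = suc zero
  δ zero (just a , nothing) = suc (suc zero)
  δ zero (just a , just b) with Fin.<-cmp a b
  ... | tri< _ _ _ = suc (suc zero)
  ... | tri≈ _ _ _ = zero
  ... | tri> _ _ _ = suc zero

  final : Fin 3 → Bool
  final zero          = true
  final (suc zero)    = true
  final (suc (suc _)) = false

lexDFA-sink : ∀ {k} i w → run (lexDFA k) (suc i) w ≡ suc i
lexDFA-sink i []      = refl
lexDFA-sink i (_ ∷ w) = lexDFA-sink i w

lexDFA-sound : ∀ {k} (u v : List (Fin k)) → Accepts (lexDFA k) (conv u v) → u ⊑ v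
lexDFA-sound []      v       _ = []⊑ v
lexDFA-sound (a ∷ u) []      p rewrite lexDFA-sink (suc zero) (conv u []) with () ← p
lexDFA-sound (a ∷ u) (b ∷ v) p with Fin.<-cmp a b
... | tri< _ _ _    rewrite lexDFA-sink (suc zero) (conv u v) with () ← p
... | tri≈ _ refl _ = next refl (lexDFA-sound u v p)
... | tri> _ _ b<a  = this b<a

lexDFA-complete : ∀ {k} {u v : List (Fin k)} → u ⊑ v → Accepts (lexDFA k) (conv u v)
lexDFA-complete (base _) = refl
lexDFA-complete {v = _ ∷ v} halt rewrite lexDFA-sink zero (conv [] v) = refl
lexDFA-complete {u = a ∷ u} {b ∷ v} (this b<a) with Fin.<-cmp a b
... | tri< _ _ b≮a = ⊥-elim (b≮a b<a)
... | tri≈ _ _ b≮a = ⊥-elim (b≮a b<a)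
... | tri> _ _ _ rewrite lexDFA-sink zero (conv u v) = refl
lexDFA-complete {u = a ∷ u} {b ∷ v} (next refl u⊑v) with Fin.<-cmp a a
... | tri< a<a _ _ = ⊥-elim (Fin.<-irrefl refl a<a)
... | tri≈ _ _ _   = lexDFA-complete u⊑v
... | tri> _ _ a<a = ⊥-elim (Fin.<-irrefl refl a<a)

-- An automaton for the words below a fixed word

-- States for c ∷ D: 0 = start, 1 = accepting sink, 2 = rejecting sink, then those for D.
belowDFA : ∀ {k} → List (Fin k) → DFA (Fin k)
belowDFA {k} [] = record { nStates = 2 ; start = zero ; δ = λ _ _ → suc zero ; final = final }
  where
  final : Fin 2 → Bool
  final zero    = true
  final (suc _) = false
belowDFA {k} (c ∷ D) = record { nStates = 3 + M.nStates ; start = zero ; δ = δ ; final = final }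
  where
  module M = DFA (belowDFA D)

  δ : Fin (3 + M.nStates) → Fin k → Fin (3 + M.nStates)
  δ (suc zero)          _ = suc zero
  δ (suc (suc zero))    _ = suc (suc zero)
  δ (suc (suc (suc q))) a = suc (suc (suc (M.δ q a)))
  δ zero a with Fin.<-cmp a c
  ... | tri< _ _ _ = suc (suc zero)
  ... | tri≈ _ _ _ = suc (suc (suc M.start))
  ... | tri> _ _ _ = suc zero

  final : Fin (3 + M.nStates) → Bool
  final zero                = true
  final (suc zero)          = true
  final (suc (suc zero))    = false
  final (suc (suc (suc q))) = M.final q

module _ {k : ℕ} (c : Fin k) (D : List (Fin k)) where

  below-accepting : ∀ w → run (belowDFA (c ∷ D)) (suc zero) w ≡ suc zero
  below-accepting []      = refl
  below-accepting (_ ∷ w) = below-accepting w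

  below-rejecting : ∀ w → run (belowDFA (c ∷ D)) (suc (suc zero)) w ≡ suc (suc zero)
  below-rejecting []      = refl
  below-rejecting (_ ∷ w) = below-rejecting w

  below-embedded : ∀ q w → run (belowDFA (c ∷ D)) (suc (suc (suc q))) w ≡
                           suc (suc (suc (run (belowDFA D) q w)))
  below-embedded q []      = refl
  below-embedded q (a ∷ w) = below-embedded (DFA.δ (belowDFA D) q a) w

below-[]-rejecting : ∀ {k} (w : List (Fin k)) → run (belowDFA []) (suc zero) w ≡ suc zero
below-[]-rejecting []      = refl
below-[]-rejecting (_ ∷ w) = below-[]-rejecting w

belowDFA-sound : ∀ {k} (w D : List (Fin k)) → Accepts (belowDFA D) w → w ⊑ D
belowDFA-sound []      D       _ = []⊑ D
belowDFA-sound (a ∷ w) []      p rewrite below-[]-rejecting w with () ← p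
belowDFA-sound (a ∷ w) (c ∷ D) p with Fin.<-cmp a c
... | tri< _ _ _    rewrite below-rejecting c D w with () ← p
... | tri≈ _ refl _ rewrite below-embedded c D (DFA.start (belowDFA D)) w = next refl (belowDFA-sound w D p)
... | tri> _ _ c<a  = this c<a

belowDFA-complete : ∀ {k} {w D : List (Fin k)} → w ⊑ D → Accepts (belowDFA D) w
belowDFA-complete (base _) = refl
belowDFA-complete halt     = refl
belowDFA-complete {w = a ∷ w} {c ∷ D} (this c<a) with Fin.<-cmp a c
... | tri< _ _ c≮a = ⊥-elim (c≮a c<a)
... | tri≈ _ _ c≮a = ⊥-elim (c≮a c<a)
... | tri> _ _ _ rewrite below-accepting c D w = refl
belowDFA-complete {w = a ∷ w} {c ∷ D} (next refl w⊑D) with Fin.<-cmp a a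
... | tri< a<a _ _ = ⊥-elim (Fin.<-irrefl refl a<a)
... | tri> _ _ a<a = ⊥-elim (Fin.<-irrefl refl a<a)
... | tri≈ _ _ _ rewrite below-embedded c D (DFA.start (belowDFA D)) w = belowDFA-complete w⊑D

-- An automaton for sorted words

Sorted : ∀ {k} → List (Fin k) → Set
Sorted = Linked Fin._≤_

-- State suc i: the last letter read was i; state 0 rejects.
sortedDFA : ∀ n → DFA (Fin (suc n))
-- Starting as if letter `zero` had been read imposes no constraint, since it is the least index.
sortedDFA n = record { nStates = suc (suc n) ; start = suc zero ; δ = δ ; final = final }
  where
  δ : Fin (suc (suc n)) → Fin (suc n) → Fin (suc (suc n))
  δ zero    _ = zero
  δ (suc i) a with i Fin.≤? a
  ... | yes _ = suc a
  ... | no  _ = zero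

  final : Fin (suc (suc n)) → Bool
  final zero    = false
  final (suc _) = true

sortedDFA-sink : ∀ {n} w → run (sortedDFA n) zero w ≡ zero
sortedDFA-sink []      = refl
sortedDFA-sink (_ ∷ w) = sortedDFA-sink w

sortedDFA-sound : ∀ {n} i w → AcceptsFrom (sortedDFA n) (suc i) w → Sorted (i ∷ w)
sortedDFA-sound i []      _ = [-]
sortedDFA-sound i (a ∷ w) p with i Fin.≤? a
... | yes i≤a = i≤a ∷ sortedDFA-sound a w p
... | no  _   rewrite sortedDFA-sink w with () ← p

sortedDFA-complete : ∀ {n i w} → Sorted (i ∷ w) → AcceptsFrom (sortedDFA n) (suc i) w
sortedDFA-complete [-] = refl
sortedDFA-complete {i = i} {a ∷ w} (i≤a ∷ s) with i Fin.≤? a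
... | yes _   = sortedDFA-complete s
... | no  i≰a = ⊥-elim (i≰a i≤a)

-- Product automata

module _ {A : Set} (D E : DFA A) where

  private
    module D = DFA D
    module E = DFA E

  _∩_ : DFA A
  _∩_ = record
    { nStates = D.nStates * E.nStates
    ; start   = combine D.start E.start
    ; δ       = λ q a → let (d , e) = remQuot E.nStates q in combine (D.δ d a) (E.δ e a)
    ; final   = λ q → let (d , e) = remQuot E.nStates q in D.final d ∧ E.final e
    }

  run-∩ : ∀ d e w → run _∩_ (combine d e) w ≡ combine (run D d w) (run E e w)
  run-∩ d e []      = refl
  run-∩ d e (a ∷ w) =
    trans (cong (λ (d , e) → run _∩_ (combine (D.δ d a) (E.δ e a)) w) (remQuot-combine d e))
          (run-∩ (D.δ d a) (E.δ e a) w)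

  final-∩ : ∀ w → DFA.final _∩_ (run _∩_ (DFA.start _∩_) w) ≡
                  D.final (run D D.start w) ∧ E.final (run E E.start w)
  final-∩ w =
    trans (cong (DFA.final _∩_) (run-∩ D.start E.start w))
          (cong (λ (d , e) → D.final d ∧ E.final e) (remQuot-combine (run D D.start w) (run E E.start w)))

  ∩-sound : ∀ w → Accepts _∩_ w → Accepts D w × Accepts E w
  ∩-sound w p = split _ _ (trans (sym (final-∩ w)) p)
    where
    split : ∀ b c → b ∧ c ≡ true → b ≡ true × c ≡ true
    split true true _ = refl , refl

  ∩-complete : ∀ w → Accepts D w → Accepts E w → Accepts _∩_ w
  ∩-complete w p q = trans (final-∩ w) (cong₂ _∧_ p q)

-- Sorted words as Cantor normal forms

count : ∀ {k} → List (Fin k) → Vec ℕ k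
count []      = 𝟎
count (a ∷ w) = updateAt (count w) a suc

updateAt-mono-≺ : ∀ {n} {u v : Vec ℕ n} i → u ≺ v → updateAt u i suc ≺ updateAt v i suc
updateAt-mono-≺ zero    (this a<b eq)   = this (s≤s a<b) eq
updateAt-mono-≺ zero    (next refl u≺v) = next refl u≺v
updateAt-mono-≺ (suc i) (this a<b eq)   = this a<b eq
updateAt-mono-≺ (suc i) (next refl u≺v) = next refl (updateAt-mono-≺ i u≺v)

≺-updateAt : ∀ {n} (v : Vec ℕ n) i → v ≺ updateAt v i suc
≺-updateAt (a ∷ v) zero    = this (n<1+n a) refl
≺-updateAt (a ∷ v) (suc i) = next refl (≺-updateAt v i)

-- The updated vector has a nonzero entry at position `i` or earlier, where `u` vanishes; the first
-- such entry decides the comparison.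
zeros≺updateAt : ∀ {n} (u v : Vec ℕ n) i → (∀ j → j Fin.≤ i → lookup u j ≡ 0) → u ≺ updateAt v i suc
zeros≺updateAt (a ∷ u) (b ∷ v) zero zeros rewrite zeros zero z≤n = this (s≤s z≤n) refl
zeros≺updateAt (a ∷ u) (zero ∷ v) (suc i) zeros rewrite zeros zero z≤n =
  next refl (zeros≺updateAt u v i λ j j≤i → zeros (suc j) (s≤s j≤i))
zeros≺updateAt (a ∷ u) (suc b ∷ v) (suc i) zeros rewrite zeros zero z≤n = this (s≤s z≤n) refl

count-zeros : ∀ {k} {i : Fin k} {w} → Sorted (i ∷ w) → ∀ j → j Fin.< i → lookup (count w) j ≡ 0
count-zeros [-] j _ = lookup-replicate j 0
count-zeros {w = a ∷ w} (i≤a ∷ s) j j<i =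
  trans (lookup∘updateAt′ j a (Fin.<⇒≢ j<a) (count w)) (count-zeros s j j<a)
  where j<a = ℕ.<-≤-trans j<i i≤a

-- At a first difference `b < a`, sortedness leaves `u` without letters up to `b` from there on,
-- whereas `v` has a `b`. Restoring the common prefix preserves `≺`.
count-mono : ∀ {k} {u v : List (Fin k)} → Sorted u → u ⊑ v → count u ≺ count v ⊎ u ≡ v
count-mono _ (base _) = inj₂ refl
count-mono {v = b ∷ v} _ halt = inj₁ (≼-≺-trans (𝟎-least (count v)) (≺-updateAt (count v) b))
count-mono {u = a ∷ u} {b ∷ v} s (this b<a) =
  inj₁ (zeros≺updateAt (count (a ∷ u)) (count v) b λ j j≤b →
    -- Doubling the head `a` makes the count include it.
    count-zeros (Fin.≤-refl ∷ s) j (ℕ.≤-<-trans j≤b b<a))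
count-mono {u = a ∷ u} s (next refl u⊑v) with count-mono (Linked.tail s) u⊑v
... | inj₁ lt   = inj₁ (updateAt-mono-≺ a lt)
... | inj₂ refl = inj₂ refl

encode : ∀ {k} → Vec ℕ k → List (Fin k)
encode []      = []
encode (a ∷ v) = List.replicate a zero ++ map suc (encode v)

zero∷-sorted : ∀ {n} {w : List (Fin (suc n))} → Sorted w → Sorted (zero ∷ w)
zero∷-sorted []        = [-]
zero∷-sorted [-]       = z≤n ∷ [-]
zero∷-sorted (x≤y ∷ s) = z≤n ∷ x≤y ∷ s

encode-sorted : ∀ {k} (v : Vec ℕ k) → Sorted (encode v)
encode-sorted []          = []
encode-sorted (zero ∷ v)  = map⁺ (Linked.map s≤s (encode-sorted v))
encode-sorted (suc a ∷ v) = zero∷-sorted (encode-sorted (a ∷ v))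

count-map-suc : ∀ {k} (w : List (Fin k)) → count (map suc w) ≡ 0 ∷ count w
count-map-suc []      = refl
count-map-suc (a ∷ w) = cong (λ v → updateAt v (suc a) suc) (count-map-suc w)

count-encode : ∀ {k} (v : Vec ℕ k) → count (encode v) ≡ v
count-encode []          = refl
count-encode (zero ∷ v)  = trans (count-map-suc (encode v)) (cong (0 ∷_) (count-encode v))
count-encode (suc a ∷ v) = cong (λ v → updateAt v zero suc) (count-encode (a ∷ v))

-- Realising the ordinals below ω^ω

module InitialSegment {n : ℕ} (d : Vec ℕ (suc n)) where

  Dom : DFA (Fin (suc n))
  Dom = sortedDFA n ∩ belowDFA (encode d)

  Carrier : Set
  Carrier = Σ (List (Fin (suc n))) (Accepts Dom)

  _<C_ : Carrier → Carrier → Set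
  x <C y = Accepts (lexDFA (suc n)) (conv (proj₁ x) (proj₁ y)) × ¬ (proj₁ x ≡ proj₁ y)

  sorted : ∀ (x : Carrier) → Sorted (proj₁ x)
  sorted (w , p) =
    Linked.tail (sortedDFA-sound zero w (proj₁ (∩-sound (sortedDFA n) (belowDFA (encode d)) w p)))

  below : ∀ (x : Carrier) → proj₁ x ⊑ encode d
  below (w , p) = belowDFA-sound w (encode d) (proj₂ (∩-sound (sortedDFA n) (belowDFA (encode d)) w p))

  element : ∀ w → Sorted w → w ⊑ encode d → Carrier
  element w s w⊑d = w , ∩-complete (sortedDFA n) (belowDFA (encode d)) w
    (sortedDFA-complete (zero∷-sorted s)) (belowDFA-complete w⊑d)

  value : Carrier → Vec ℕ (suc n)
  value (w , _) = count w

  value-mono : ∀ x y → x <C y → value x ≺ value y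
  value-mono x y (x≤y , x≢y) with count-mono (sorted x) (lexDFA-sound (proj₁ x) (proj₁ y) x≤y)
  ... | inj₁ lt = lt
  ... | inj₂ eq = ⊥-elim (x≢y eq)

  <C-wellFounded : WellFounded _<C_
  <C-wellFounded = Subrelation.wellFounded (λ {x} {y} → value-mono x y) (on-wellFounded value ≺-wellFounded)

  -- The preimage is `encode e`. By totality it could otherwise only lie above `x`, and then
  -- `count-mono` would contradict `e ≺ value x`.
  value-lift : ∀ x e → e ≺ value x → Σ Carrier (λ y → y <C x × value y ≡ e)
  value-lift x e e≺x with ⊑.total (encode e) (proj₁ x)
  ... | inj₁ e⊑x = element (encode e) (encode-sorted e) (⊑.trans e⊑x (below x)) ,
                   (lexDFA-complete e⊑x , e≢x) , count-encode e
    where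
    e≢x : encode e ≢ proj₁ x
    e≢x eq = ≺-irrefl (subst (_≺ value x) (trans (sym (count-encode e)) (cong count eq)) e≺x)
  ... | inj₂ x⊑e with count-mono (sorted x) x⊑e
  ...   | inj₁ x≺e = ⊥-elim (≺-irrefl (≺-trans e≺x (subst (value x ≺_) (count-encode e) x≺e)))
  ...   | inj₂ eq  = ⊥-elim (≺-irrefl (subst (e ≺_) (trans (cong count eq) (count-encode e)) e≺x))

  segment : AutomaticWFPO
  segment = record
    { k        = suc n
    ; Dom      = Dom
    ; Ord≤     = lexDFA (suc n)
    ; refl≤    = λ x → lexDFA-complete {u = proj₁ x} ⊑.refl
    ; antisym≤ = λ x y x≤y y≤x → ListPointwise.Pointwise-≡⇒≡
        (⊑.antisym (lexDFA-sound (proj₁ x) (proj₁ y) x≤y) (lexDFA-sound (proj₁ y) (proj₁ x) y≤x))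
    ; trans≤   = λ x y z x≤y y≤z → lexDFA-complete {u = proj₁ x} {proj₁ z}
        (⊑.trans (lexDFA-sound (proj₁ x) (proj₁ y) x≤y) (lexDFA-sound (proj₁ y) (proj₁ z) y≤z))
    ; wf<      = <C-wellFounded
    }

  open RankComparison <C-wellFounded ≺-wellFounded value

  value≼d : ∀ x → value x ≼ d
  value≼d x with count-mono (sorted x) (below x)
  ... | inj₁ lt = inj₁ (subst (value x ≺_) (count-encode d) lt)
  ... | inj₂ eq = inj₂ (trans (cong count eq) (count-encode d))

  height≈⟦d⟧ : AutomaticWFPO.height segment ≈ₒ ⟦ d ⟧
  height≈⟦d⟧ = height≤ , Val.rank-least d <height
    where
    height≤ : AutomaticWFPO.height segment ≤ₒ ⟦ d ⟧
    height≤ (x , y , y<x) = ≤ₒ-<ₒ-trans (rank-mono (λ {x} {y} → value-mono x y) y)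
      (Val.<⇒rank< (≺-≼-trans (value-mono y x y<x) (value≼d x)))

    -- The height ranges only over elements with something above them; `top` supplies this for every
    -- `e ≺ d`.
    top : Carrier
    top = element (encode d) (encode-sorted d) ⊑.refl

    <height : ∀ e → e ≺ d → ⟦ e ⟧ <ₒ AutomaticWFPO.height segment
    <height e e≺d with value-lift top e (subst (e ≺_) (sym (count-encode d)) e≺d)
    ... | y , y<top , refl = (top , y , y<top) , rank-reflect value-lift y

-- Combination of the two directions

theorem1 : ExcludedMiddle (Level.suc 0ℓ) →
    (α : Ord) →
    (Σ AutomaticWFPO (λ P → AutomaticWFPO.height P ≈ₒ α)) ⇔ (α <ₒ ω^ω)
theorem1 em α = mk⇔ bounded realised
  where
  em₀ : ExcludedMiddle 0ℓ
  em₀ {P} = map′ lower lift (em {Lift _ P})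

  bounded : Σ AutomaticWFPO (λ P → AutomaticWFPO.height P ≈ₒ α) → α <ₒ ω^ω
  bounded (P , _ , α≤height) = ≤ₒ-<ₒ-trans α≤height (UpperBound.height<ω^ω em₀ P)

  realised : α <ₒ ω^ω → Σ AutomaticWFPO (λ P → AutomaticWFPO.height P ≈ₒ α)
  realised α<ω^ω with <ω^ω⇒≤⟦⟧ α<ω^ω
  ... | n , v , α≤v with Classical.≤⟦⟧⇒≈⟦⟧ em₀ α v α≤v
  ...   | d , α≤d , d≤α = segment , ≤ₒ-trans (proj₁ height≈⟦d⟧) d≤α , ≤ₒ-trans α≤d (proj₂ height≈⟦d⟧)
    where open InitialSegment d
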